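{- Let $k\ge 0$ be an integer and let $G$ be a graph with $m$ edges, where $m\ge\max\{\tfrac{1}{2}k^2+6k+3,\,7k+25\}$. If $q(G)\ge m-k+1$, then $G$ contains $K_{1,m-k}$ as a subgraph.
   Context: All graphs are finite, simple and undirected. $q(G)$ denotes the signless Laplacian spectral radius of $G$, i.e. the largest eigenvalue of $Q(G)=D(G)+A(G)$, where $A(G)$ is the adjacency matrix and $D(G)$ the diagonal matrix of vertex degrees. $K_{1,t}$ denotes the star with $t$ edges (on $t+1$ vertices). -}

module Defs where

open import Data.Bool.Base using (if_then_else_)
open import Data.Fin.Base using (Fin; zero)
import Data.Fin.Properties as Fin
open import Data.Integer.Base using (+_)
open import Data.List.Base using (List; length; filter; allFin; cartesianProduct)
open import Data.Nat.Base using (ℕ; suc)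
import Data.Nat.Base as ℕ
import Data.Nat.Properties as ℕ
open import Data.Product.Base using (Σ; ∃-syntax; _×_; _,_; proj₁; proj₂)
open import Data.Rational.Base as ℚ using (ℚ; 0ℚ; 1ℚ; ½; ∣_∣; positive; nonNegative)
import Data.Rational.Properties as ℚ
open import Data.Rational.Solver using (module +-*-Solver)
open import Data.Sum.Base using (_⊎_; inj₁; inj₂)
import Data.Vec.Functional as Vector
open import Function.Definitions using (Injective)
open import Level using (0ℓ)
open import Relation.Binary.Core using (Rel)
open import Relation.Binary.Definitions using (Decidable; Symmetric)
open import Relation.Binary.PropositionalEquality using (_≡_; _≢_; refl; sym; trans; cong; subst)
open import Relation.Nullary using (¬_; does; ¬?)
open import Relation.Nullary.Decidable using (_×-dec_; _⊎-dec_)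

ℕ→ℚ : ℕ → ℚ
ℕ→ℚ n = + n ℚ./ 1

-- Reals are Cauchy sequences of rationals; equality of reals is _≃_, not _≡_.
Cauchy : (ℕ → ℚ) → Set
Cauchy x = ∀ ε → 0ℚ ℚ.< ε →
  ∃[ N ] (∀ i j → N ℕ.≤ i → N ℕ.≤ j → ∣ x i ℚ.- x j ∣ ℚ.< ε)

record ℝ : Set where
  constructor mkℝ
  field
    seq    : ℕ → ℚ
    cauchy : Cauchy seq

open ℝ public

infix 4 _≃_ _≤ℝ_

_≃_ : Rel ℝ 0ℓ
x ≃ y = ∀ ε → 0ℚ ℚ.< ε →
  ∃[ N ] (∀ i → N ℕ.≤ i → ∣ seq x i ℚ.- seq y i ∣ ℚ.< ε)

-- The slack ε is needed: pointwise comparison of representatives does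
-- not respect _≃_.
_≤ℝ_ : Rel ℝ 0ℓ
x ≤ℝ y = ∀ ε → 0ℚ ℚ.< ε →
  ∃[ N ] (∀ i → N ℕ.≤ i → seq x i ℚ.< seq y i ℚ.+ ε)

private
  open +-*-Solver

  +-diff : ∀ a b c d → (a ℚ.+ b) ℚ.- (c ℚ.+ d) ≡ (a ℚ.- c) ℚ.+ (b ℚ.- d)
  +-diff = solve 4 (λ a b c d → (a :+ b) :- (c :+ d) := (a :- c) :+ (b :- d)) refl

  neg-diff : ∀ a b → ℚ.- (a ℚ.- b) ≡ (ℚ.- a) ℚ.- (ℚ.- b)
  neg-diff = solve 2 (λ a b → :- (a :- b) := (:- a) :- (:- b)) refl

  split : ∀ a b → a ≡ (a ℚ.- b) ℚ.+ b
  split = solve 2 (λ a b → a := (a :- b) :+ b) refl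

  *-diff : ∀ a b c d → a ℚ.* b ℚ.- c ℚ.* d ≡ a ℚ.* (b ℚ.- d) ℚ.+ d ℚ.* (a ℚ.- c)
  *-diff = solve 4 (λ a b c d → a :* b :- c :* d := a :* (b :- d) :+ d :* (a :- c)) refl

  inverse : ∀ p → 0ℚ ℚ.< p → ∃[ r ] (0ℚ ℚ.< r × p ℚ.* r ≡ 1ℚ)
  inverse p 0<p = ℚ.1/ p , ℚ.positive⁻¹ (ℚ.1/ p) {{ℚ.1/pos⇒pos p}} , ℚ.*-inverseʳ p
    where
    instance
      p>0 : ℚ.Positive p
      p>0 = positive 0<p
      p≢0 : ℚ.NonZero p
      p≢0 = ℚ.pos⇒nonZero p

  ∣*∣-bound : ∀ a b B δ → 0ℚ ℚ.< B → ∣ a ∣ ℚ.≤ B → ∣ b ∣ ℚ.< δ → ∣ a ℚ.* b ∣ ℚ.< B ℚ.* δ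
  ∣*∣-bound a b B δ 0<B ∣a∣≤B ∣b∣<δ = begin-strict
    ∣ a ℚ.* b ∣      ≡⟨ ℚ.∣p*q∣≡∣p∣*∣q∣ a b ⟩
    ∣ a ∣ ℚ.* ∣ b ∣  ≤⟨ ℚ.*-monoʳ-≤-nonNeg ∣ b ∣ {{nonNegative (ℚ.0≤∣p∣ b)}} ∣a∣≤B ⟩
    B ℚ.* ∣ b ∣      <⟨ ℚ.*-monoʳ-<-pos B {{positive 0<B}} ∣b∣<δ ⟩
    B ℚ.* δ          ∎
    where open ℚ.≤-Reasoning

const-cauchy : ∀ p → Cauchy (λ _ → p)
const-cauchy p ε 0<ε = 0 , λ _ _ _ _ →
  subst (λ d → ∣ d ∣ ℚ.< ε) (sym (ℚ.+-inverseʳ p)) 0<ε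

+-cauchy : ∀ {x y} → Cauchy x → Cauchy y → Cauchy (λ i → x i ℚ.+ y i)
+-cauchy {x} {y} cx cy ε 0<ε = Nx ℕ.⊔ Ny , bound
  where
  open ℚ.≤-Reasoning
  δ = ½ ℚ.* ε
  0<δ : 0ℚ ℚ.< δ
  0<δ = subst (ℚ._< δ) (ℚ.*-zeroʳ ½) (ℚ.*-monoʳ-<-pos ½ 0<ε)
  Nx = proj₁ (cx δ 0<δ)
  Ny = proj₁ (cy δ 0<δ)
  bound : ∀ i j → Nx ℕ.⊔ Ny ℕ.≤ i → Nx ℕ.⊔ Ny ℕ.≤ j →
          ∣ (x i ℚ.+ y i) ℚ.- (x j ℚ.+ y j) ∣ ℚ.< ε
  bound i j N≤i N≤j = begin-strict
    ∣ (x i ℚ.+ y i) ℚ.- (x j ℚ.+ y j) ∣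
      ≡⟨ cong ∣_∣ (+-diff (x i) (y i) (x j) (y j)) ⟩
    ∣ (x i ℚ.- x j) ℚ.+ (y i ℚ.- y j) ∣
      ≤⟨ ℚ.∣p+q∣≤∣p∣+∣q∣ (x i ℚ.- x j) (y i ℚ.- y j) ⟩
    ∣ x i ℚ.- x j ∣ ℚ.+ ∣ y i ℚ.- y j ∣
      <⟨ ℚ.+-mono-<
           (proj₂ (cx δ 0<δ) i j (ℕ.m⊔n≤o⇒m≤o Nx Ny N≤i) (ℕ.m⊔n≤o⇒m≤o Nx Ny N≤j))
           (proj₂ (cy δ 0<δ) i j (ℕ.m⊔n≤o⇒n≤o Nx Ny N≤i) (ℕ.m⊔n≤o⇒n≤o Nx Ny N≤j)) ⟩
    δ ℚ.+ δ
      ≡⟨ sym (ℚ.*-distribʳ-+ ε ½ ½) ⟩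
    1ℚ ℚ.* ε
      ≡⟨ ℚ.*-identityˡ ε ⟩
    ε ∎

neg-cauchy : ∀ {x} → Cauchy x → Cauchy (λ i → ℚ.- x i)
neg-cauchy {x} cx ε 0<ε with cx ε 0<ε
... | N , bound = N , λ i j N≤i N≤j →
  subst (ℚ._< ε) (flip i j) (bound i j N≤i N≤j)
  where
  flip : ∀ i j → ∣ x i ℚ.- x j ∣ ≡ ∣ (ℚ.- x i) ℚ.- (ℚ.- x j) ∣
  flip i j = trans (sym (ℚ.∣-p∣≡∣p∣ (x i ℚ.- x j)))
    (cong ∣_∣ (neg-diff (x i) (x j)))

cauchy-bounded : ∀ {x} → Cauchy x →
  ∃[ B ] (0ℚ ℚ.< B × ∃[ N ] (∀ i → N ℕ.≤ i → ∣ x i ∣ ℚ.≤ B))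
cauchy-bounded {x} cx = B , 0<B , N , bound
  where
  open ℚ.≤-Reasoning
  0<1 : 0ℚ ℚ.< 1ℚ
  0<1 = ℚ.positive⁻¹ 1ℚ
  N = proj₁ (cx 1ℚ 0<1)
  B = 1ℚ ℚ.+ ∣ x N ∣
  0<B : 0ℚ ℚ.< B
  0<B = ℚ.+-mono-<-≤ 0<1 (ℚ.0≤∣p∣ (x N))
  bound : ∀ i → N ℕ.≤ i → ∣ x i ∣ ℚ.≤ B
  bound i N≤i = begin
    ∣ x i ∣
      ≡⟨ cong ∣_∣ (split (x i) (x N)) ⟩
    ∣ (x i ℚ.- x N) ℚ.+ x N ∣
      ≤⟨ ℚ.∣p+q∣≤∣p∣+∣q∣ (x i ℚ.- x N) (x N) ⟩
    ∣ x i ℚ.- x N ∣ ℚ.+ ∣ x N ∣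
      ≤⟨ ℚ.+-monoˡ-≤ ∣ x N ∣ (ℚ.<⇒≤ (proj₂ (cx 1ℚ 0<1) i N N≤i ℕ.≤-refl)) ⟩
    B ∎

*-cauchy : ∀ {x y} → Cauchy x → Cauchy y → Cauchy (λ i → x i ℚ.* y i)
*-cauchy {x} {y} cx cy ε 0<ε =
  let B , 0<B , M , ∣x∣≤B = cauchy-bounded {x} cx
      C , 0<C , L , ∣y∣≤C = cauchy-bounded {y} cy
      r , 0<r , [B+C]*r≡1 = inverse (B ℚ.+ C) (ℚ.+-mono-< 0<B 0<C)
  in go B 0<B M ∣x∣≤B C 0<C L ∣y∣≤C r 0<r [B+C]*r≡1
  where
  module _ (B : ℚ) (0<B : 0ℚ ℚ.< B) (M : ℕ) (∣x∣≤B : ∀ i → M ℕ.≤ i → ∣ x i ∣ ℚ.≤ B)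
           (C : ℚ) (0<C : 0ℚ ℚ.< C) (L : ℕ) (∣y∣≤C : ∀ i → L ℕ.≤ i → ∣ y i ∣ ℚ.≤ C)
           (r : ℚ) (0<r : 0ℚ ℚ.< r) ([B+C]*r≡1 : (B ℚ.+ C) ℚ.* r ≡ 1ℚ) where
    open ℚ.≤-Reasoning
    δ = r ℚ.* ε
    0<δ : 0ℚ ℚ.< δ
    0<δ = ℚ.positive⁻¹ δ {{ℚ.pos*pos⇒pos r {{positive 0<r}} ε {{positive 0<ε}}}}
    Nx = proj₁ (cx δ 0<δ)
    Ny = proj₁ (cy δ 0<δ)
    N = (M ℕ.⊔ L) ℕ.⊔ (Nx ℕ.⊔ Ny)
    module _ {i} (N≤i : N ℕ.≤ i) where
      M⊔L≤i = ℕ.m⊔n≤o⇒m≤o (M ℕ.⊔ L) (Nx ℕ.⊔ Ny) N≤i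
      Nx⊔Ny≤i = ℕ.m⊔n≤o⇒n≤o (M ℕ.⊔ L) (Nx ℕ.⊔ Ny) N≤i
      M≤ = ℕ.m⊔n≤o⇒m≤o M L M⊔L≤i
      L≤ = ℕ.m⊔n≤o⇒n≤o M L M⊔L≤i
      Nx≤ = ℕ.m⊔n≤o⇒m≤o Nx Ny Nx⊔Ny≤i
      Ny≤ = ℕ.m⊔n≤o⇒n≤o Nx Ny Nx⊔Ny≤i
    bound : ∀ i j → N ℕ.≤ i → N ℕ.≤ j → ∣ x i ℚ.* y i ℚ.- x j ℚ.* y j ∣ ℚ.< ε
    bound i j N≤i N≤j = begin-strict
      ∣ x i ℚ.* y i ℚ.- x j ℚ.* y j ∣
        ≡⟨ cong ∣_∣ (*-diff (x i) (y i) (x j) (y j)) ⟩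
      ∣ x i ℚ.* Δy ℚ.+ y j ℚ.* Δx ∣
        ≤⟨ ℚ.∣p+q∣≤∣p∣+∣q∣ (x i ℚ.* Δy) (y j ℚ.* Δx) ⟩
      ∣ x i ℚ.* Δy ∣ ℚ.+ ∣ y j ℚ.* Δx ∣
        <⟨ ℚ.+-mono-<
             (∣*∣-bound (x i) Δy B δ 0<B (∣x∣≤B i (M≤ N≤i))
               (proj₂ (cy δ 0<δ) i j (Ny≤ N≤i) (Ny≤ N≤j)))
             (∣*∣-bound (y j) Δx C δ 0<C (∣y∣≤C j (L≤ N≤j))
               (proj₂ (cx δ 0<δ) i j (Nx≤ N≤i) (Nx≤ N≤j))) ⟩
      B ℚ.* δ ℚ.+ C ℚ.* δ
        ≡⟨ sym (ℚ.*-distribʳ-+ δ B C) ⟩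
      (B ℚ.+ C) ℚ.* (r ℚ.* ε)
        ≡⟨ sym (ℚ.*-assoc (B ℚ.+ C) r ε) ⟩
      ((B ℚ.+ C) ℚ.* r) ℚ.* ε
        ≡⟨ cong (ℚ._* ε) [B+C]*r≡1 ⟩
      1ℚ ℚ.* ε
        ≡⟨ ℚ.*-identityˡ ε ⟩
      ε ∎
      where
      Δx = x i ℚ.- x j
      Δy = y i ℚ.- y j
    go : ∃[ K ] (∀ i j → K ℕ.≤ i → K ℕ.≤ j → ∣ x i ℚ.* y i ℚ.- x j ℚ.* y j ∣ ℚ.< ε)
    go = N , bound

infixl 6 _+ℝ_ _-ℝ_
infixl 7 _*ℝ_
infix  8 -ℝ_

ℚ→ℝ : ℚ → ℝ
ℚ→ℝ p = mkℝ (λ _ → p) (const-cauchy p)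

ℕ→ℝ : ℕ → ℝ
ℕ→ℝ n = ℚ→ℝ (ℕ→ℚ n)

0ℝ 1ℝ : ℝ
0ℝ = ℚ→ℝ 0ℚ
1ℝ = ℚ→ℝ 1ℚ

-ℝ_ : ℝ → ℝ
-ℝ x = mkℝ (λ i → ℚ.- seq x i) (neg-cauchy {seq x} (cauchy x))

_+ℝ_ _*ℝ_ : ℝ → ℝ → ℝ
x +ℝ y = mkℝ (λ i → seq x i ℚ.+ seq y i) (+-cauchy {seq x} {seq y} (cauchy x) (cauchy y))
x *ℝ y = mkℝ (λ i → seq x i ℚ.* seq y i) (*-cauchy {seq x} {seq y} (cauchy x) (cauchy y))

_-ℝ_ : ℝ → ℝ → ℝ
x -ℝ y = x +ℝ (-ℝ y)

Matrix : ℕ → Set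
Matrix n = Fin n → Fin n → ℝ

∑ : ∀ {n} → (Fin n → ℝ) → ℝ
∑ = Vector.foldr _+ℝ_ 0ℝ

_·_ : ∀ {n} → Matrix n → (Fin n → ℝ) → (Fin n → ℝ)
(M · v) i = ∑ (λ j → M i j *ℝ v j)

-- Real eigenvalues with real eigenvectors; for the symmetric matrices
-- considered here these are all the eigenvalues.
IsEigenvalue : ∀ {n} → Matrix n → ℝ → Set
IsEigenvalue M μ = ∃[ v ] (¬ (∀ i → v i ≃ 0ℝ) × (∀ i → (M · v) i ≃ μ *ℝ v i))

IsLargestEigenvalue : ∀ {n} → Matrix n → ℝ → Set
IsLargestEigenvalue M q = IsEigenvalue M q × (∀ μ → IsEigenvalue M μ → μ ≤ℝ q)

record Graph : Set₁ where
  infix 4 _~_ _~?_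
  field
    order  : ℕ
    _~_    : Rel (Fin order) 0ℓ
    _~?_   : Decidable _~_
    ~-sym  : Symmetric _~_
    ~-irr  : ∀ {v} → ¬ (v ~ v)

  Vertex : Set
  Vertex = Fin order

  neighbours : Vertex → List Vertex
  neighbours v = filter (v ~?_) (allFin order)

  degree : Vertex → ℕ
  degree v = length (neighbours v)

  -- each edge {u , v} is listed once, as the pair with u < v
  edges : List (Vertex × Vertex)
  edges = filter (λ (u , v) → (u Fin.<? v) ×-dec (u ~? v))
                 (cartesianProduct (allFin order) (allFin order))

  size : ℕ
  size = length edges

  adjacencyMatrix : Matrix order
  adjacencyMatrix u v = if does (u ~? v) then 1ℝ else 0ℝ

  degreeMatrix : Matrix order
  degreeMatrix u v = if does (u Fin.≟ v) then ℕ→ℝ (degree u) else 0ℝ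

  signlessLaplacian : Matrix order
  signlessLaplacian u v = degreeMatrix u v +ℝ adjacencyMatrix u v

-- The relation q = q(G); it determines q up to _≃_.
IsSignlessLaplacianSpectralRadius : Graph → ℝ → Set
IsSignlessLaplacianSpectralRadius G q = IsLargestEigenvalue (Graph.signlessLaplacian G) q

-- G has a (not necessarily induced) subgraph isomorphic to H.
_ContainsSubgraph_ : Graph → Graph → Set
G ContainsSubgraph H = Σ (H.Vertex → G.Vertex) λ f →
  Injective _≡_ _≡_ f × (∀ {u v} → u H.~ v → f u G.~ f v)
  where
  module G = Graph G
  module H = Graph H

K₁, : ℕ → Graph
K₁, t = record
  { order = suc t
  ; _~_   = λ u v → (u ≡ zero × v ≢ zero) ⊎ (u ≢ zero × v ≡ zero)
  ; _~?_  = λ u v → ((u Fin.≟ zero) ×-dec ¬? (v Fin.≟ zero))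
                    ⊎-dec (¬? (u Fin.≟ zero) ×-dec (v Fin.≟ zero))
  ; ~-sym = λ where
      (inj₁ (u≡0 , v≢0)) → inj₂ (v≢0 , u≡0)
      (inj₂ (u≢0 , v≡0)) → inj₁ (v≡0 , u≢0)
  ; ~-irr = λ where
      (inj₁ (v≡0 , v≢0)) → v≢0 v≡0
      (inj₂ (v≢0 , v≡0)) → v≢0 v≡0
  }

{-# OPTIONS --safe #-}
-- Write t = m - k and suppose that every degree is at most D = t - 1.  For a
-- vertex u of degree d let S be the sum of the degrees of its neighbours.  Then
-- d² + S + 1 ≤ d (t + 1) whenever d ≥ 1: for d ≥ 3 this follows from the handshake
-- bound S + d ≤ 2m and (d - 3)(D - d) ≥ 0, and for d ≤ 2 from S ≤ d D, improved by
-- one when d = 2.  So Q p < (t + 1) p entrywise for the positive integral vector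
-- p u = max(1, d(u)).  If Q v = q v with q ≥ t + 1, then at a vertex maximising
-- |v u| / p u the two estimates are incompatible unless v = 0.  The maximum is
-- taken over rational approximations of v, with errors controlled by the integral
-- gap in Q p < (t + 1) p.
module Submission where

open import Defs
open import Algebra.Bundles using (CommutativeRing; Monoid)
import Algebra.Properties.Monoid.Sum as MonoidSum
import Algebra.Properties.Semiring.Sum as SemiringSum
open import Data.Bool.Base using (true; false; if_then_else_)
open import Data.Fin.Base as Fin using (Fin; zero; suc; inject≤)
import Data.Fin.Properties as Fin
import Data.Integer.Base as ℤ
import Data.Integer.Properties as ℤ
open import Data.List.Base using (List; []; _∷_; _++_; length; filter; map; tabulate; allFin; lookup; cartesianProduct)
import Data.List.Extrema as Extrema
open import Data.List.Membership.Propositional.Properties using (∈-allFin; ∈-filter⁻; ∈-lookup)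
import Data.List.Properties as List
import Data.List.Relation.Unary.All as All
open import Data.List.Relation.Unary.AllPairs using (_∷_)
open import Data.List.Relation.Unary.Unique.Propositional using (Unique)
import Data.List.Relation.Unary.Unique.Propositional.Properties as Unique
open import Data.Nat.Base as ℕ using (ℕ; zero; suc; z≤n; s≤s; _∸_)
import Data.Nat.Properties as ℕ
open import Data.Nat.Tactic.RingSolver using (solve-∀)
open import Data.Product.Base using (∃-syntax; _×_; _,_; proj₁; proj₂)
open import Data.Rational.Base as ℚ using (ℚ; 0ℚ; 1ℚ; ½; ∣_∣; 1/_; toℚᵘ; positive; nonNegative; _+_; _-_; _*_; _⊔_; _≤_; _<_)
import Data.Rational.Properties as ℚ
open import Data.Rational.Solver using (module +-*-Solver)
open import Data.Rational.Unnormalised.Base as ℚᵘ using (mkℚᵘ; *≡*; *≤*)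
import Data.Rational.Unnormalised.Properties as ℚᵘ
open import Data.Sum.Base using (inj₁; inj₂)
open import Function.Base using (_∘_; id)
open import Function.Definitions using (Injective)
open import Relation.Binary.Bundles using (DecTotalOrder)
open import Relation.Binary.Definitions using (tri<; tri≈; tri>)
open import Relation.Binary.PropositionalEquality using (_≡_; _≢_; refl; sym; trans; cong; cong₂; subst; subst₂; module ≡-Reasoning)
open import Relation.Nullary using (¬_; Dec; yes; no; does; contradiction)
open import Relation.Nullary.Decidable using (_×-dec_; dec-true; dec-false; toWitness)
open import Relation.Unary using (Pred; Decidable)

open +-*-Solver using (solve; _:=_; _:+_; _:*_; _:-_; :-_)

module ℕΣ = SemiringSum ℕ.+-*-semiring
module ℚΣ = SemiringSum (CommutativeRing.semiring ℚ.+-*-commutativeRing)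

-- Finite sums and counting

-- Stated over an arbitrary monoid because it serves both the counting sums in `ℕ` and the matrix
-- sums in `ℚ`.
sum-supported-at : ∀ {c ℓ} (M : Monoid c ℓ) → let open Monoid M; open MonoidSum M using (sum) in
  ∀ {n} (f : Fin n → Carrier) i → (∀ j → i ≢ j → f j ≈ ε) → sum f ≈ f i
sum-supported-at M {suc n} f zero f≈0 = M.trans (M.∙-congˡ (M.trans
    (MonoidSum.sum-cong-≋ M (λ j → f≈0 (suc j) λ ())) (MonoidSum.sum-replicate-zero M n)))
  (M.identityʳ (f zero))
  where module M = Monoid M
sum-supported-at M f (suc i) f≈0 = M.trans (M.∙-cong (f≈0 zero λ ())
    (sum-supported-at M (f ∘ suc) i λ j i≢j → f≈0 (suc j) (i≢j ∘ Fin.suc-injective)))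
  (M.identityˡ (f (suc i)))
  where module M = Monoid M

sum-mono-≤ : ∀ {n} {f g : Fin n → ℕ} → (∀ i → f i ℕ.≤ g i) → ℕΣ.sum f ℕ.≤ ℕΣ.sum g
sum-mono-≤ {zero}  f≤g = z≤n
sum-mono-≤ {suc n} f≤g = ℕ.+-mono-≤ (f≤g zero) (sum-mono-≤ (f≤g ∘ suc))

term≤sum : ∀ {n} (f : Fin n → ℕ) i → f i ℕ.≤ ℕΣ.sum f
term≤sum f zero    = ℕ.m≤m+n _ _
term≤sum f (suc i) = ℕ.≤-trans (term≤sum (f ∘ suc) i) (ℕ.m≤n+m _ _)

-- Branching on `does` makes the indicator agree with the tests inside `filter` and with the
-- `if does` entries of the matrices.
𝟙 : ∀ {a} {P : Set a} → Dec P → ℕ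
𝟙 P? = if does P? then 1 else 0

𝟙-yes : ∀ {a} {P : Set a} (P? : Dec P) → P → 𝟙 P? ≡ 1
𝟙-yes P? p = cong (if_then 1 else 0) (dec-true P? p)

𝟙-no : ∀ {a} {P : Set a} (P? : Dec P) → ¬ P → 𝟙 P? ≡ 0
𝟙-no P? ¬p = cong (if_then 1 else 0) (dec-false P? ¬p)

𝟙≤1 : ∀ {a} {P : Set a} (P? : Dec P) → 𝟙 P? ℕ.≤ 1
𝟙≤1 (yes _) = ℕ.≤-refl
𝟙≤1 (no _)  = z≤n

-- Spreads a single value over the whole index set, so that it can be merged with other sums and
-- estimated term by term.
sum-𝟙≡ : ∀ {n} (i : Fin n) (f : Fin n → ℕ) → ℕΣ.sum (λ j → 𝟙 (i Fin.≟ j) ℕ.* f j) ≡ f i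
sum-𝟙≡ i f = trans
  (sum-supported-at ℕ.+-0-monoid _ i λ j i≢j → cong (ℕ._* f j) (𝟙-no (i Fin.≟ j) i≢j))
  (trans (cong (ℕ._* f i) (𝟙-yes (i Fin.≟ i) refl)) (ℕ.*-identityˡ (f i)))

length-filter-tabulate : ∀ {a p} {A : Set a} {P : Pred A p} (P? : Decidable P) {n} (f : Fin n → A) →
  length (filter P? (tabulate f)) ≡ ℕΣ.sum (λ i → 𝟙 (P? (f i)))
length-filter-tabulate P? {zero}  f = refl
length-filter-tabulate P? {suc n} f with does (P? (f zero))
... | true  = cong suc (length-filter-tabulate P? (f ∘ suc))
... | false = length-filter-tabulate P? (f ∘ suc)

length-filter-map : ∀ {a b p} {A : Set a} {B : Set b} {P : Pred B p} (P? : Decidable P) (f : A → B) xs →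
  length (filter P? (map f xs)) ≡ length (filter (P? ∘ f) xs)
length-filter-map P? f []       = refl
length-filter-map P? f (x ∷ xs) with does (P? (f x))
... | true  = cong suc (length-filter-map P? f xs)
... | false = length-filter-map P? f xs

-- Row by row, this turns the edge count `size` into a double sum of indicators.
length-filter-cartesianProduct : ∀ {a b p} {A : Set a} {B : Set b} {P : Pred (A × B) p}
  (P? : Decidable P) {n} (f : Fin n → A) ys →
  length (filter P? (cartesianProduct (tabulate f) ys)) ≡
  ℕΣ.sum (λ i → length (filter (λ y → P? (f i , y)) ys))
length-filter-cartesianProduct P? {zero}  f ys = refl
length-filter-cartesianProduct P? {suc n} f ys = begin
  length (filter P? (row ++ rest))
    ≡⟨ cong length (List.filter-++ P? row rest) ⟩
  length (filter P? row ++ filter P? rest)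
    ≡⟨ List.length-++ (filter P? row) ⟩
  length (filter P? row) ℕ.+ length (filter P? rest)
    ≡⟨ cong₂ ℕ._+_ (length-filter-map P? (f zero ,_) ys)
                   (length-filter-cartesianProduct P? (f ∘ suc) ys) ⟩
  ℕΣ.sum (λ i → length (filter (λ y → P? (f i , y)) ys)) ∎
  where
  open ≡-Reasoning
  row  = map (f zero ,_) ys
  rest = cartesianProduct (tabulate (f ∘ suc)) ys

lookup-injective : ∀ {a} {A : Set a} {xs : List A} → Unique xs → Injective _≡_ _≡_ (lookup xs)
lookup-injective (x∉ ∷ _)  {zero}  {zero}  _  = refl
lookup-injective (x∉ ∷ _)  {zero}  {suc j} eq = contradiction eq (All.lookup x∉ (∈-lookup j))
lookup-injective (x∉ ∷ _)  {suc i} {zero}  eq = contradiction (sym eq) (All.lookup x∉ (∈-lookup i))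
lookup-injective (_  ∷ xs) {suc i} {suc j} eq = cong suc (lookup-injective xs eq)

-- Degrees in graphs

module _ (G : Graph) where
  open Graph G

  adj : Vertex → Vertex → ℕ
  adj u v = 𝟙 (u ~? v)

  adj-sym : ∀ u v → adj u v ≡ adj v u
  adj-sym u v with u ~? v
  ... | yes u~v = sym (𝟙-yes (v ~? u) (~-sym u~v))
  ... | no u≁v  = sym (𝟙-no (v ~? u) (u≁v ∘ ~-sym))

  lookup-neighbours-~ : ∀ u i → u ~ lookup (neighbours u) i
  lookup-neighbours-~ u i = proj₂ (∈-filter⁻ (u ~?_) {xs = allFin order} (∈-lookup i))

  -- The leaves are the first `t` entries of the neighbour list. That list has no repetitions, and
  -- irreflexivity separates the centre from the leaves.
  degree⇒star : ∀ {t} u → t ℕ.≤ degree u → G ContainsSubgraph (K₁, t)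
  degree⇒star {t} u t≤d = f , (λ {i} {j} → f-injective i j) , f-~
    where
    leaf : Fin t → Vertex
    leaf i = lookup (neighbours u) (inject≤ i t≤d)

    u~leaf : ∀ i → u ~ leaf i
    u~leaf i = lookup-neighbours-~ u (inject≤ i t≤d)

    u≢leaf : ∀ i → u ≢ leaf i
    u≢leaf i u≡ = ~-irr (subst (_~ leaf i) u≡ (u~leaf i))

    f : Fin (suc t) → Vertex
    f zero    = u
    f (suc i) = leaf i

    f-injective : ∀ i j → f i ≡ f j → i ≡ j
    f-injective zero    zero    _  = refl
    f-injective zero    (suc j) eq = contradiction eq (u≢leaf j)
    f-injective (suc i) zero    eq = contradiction (sym eq) (u≢leaf i)
    f-injective (suc i) (suc j) eq = cong suc (Fin.inject≤-injective t≤d t≤d i j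
      (lookup-injective (Unique.filter⁺ (u ~?_) (Unique.allFin⁺ order)) eq))

    f-~ : ∀ {i j} → Graph._~_ (K₁, t) i j → f i ~ f j
    f-~ {_}     {zero}  (inj₁ (_ , j≢0))    = contradiction refl j≢0
    f-~ {_}     {suc j} (inj₁ (refl , _))   = u~leaf j
    f-~ {zero}  {_}     (inj₂ (i≢0 , _))    = contradiction refl i≢0
    f-~ {suc i} {_}     (inj₂ (_ , refl))   = ~-sym (u~leaf i)

  degree≡sum-adj : ∀ u → degree u ≡ ℕΣ.sum (adj u)
  degree≡sum-adj u = length-filter-tabulate (u ~?_) id

  adj≤degree : ∀ u v → adj u v ℕ.≤ degree u
  adj≤degree u v = ℕ.≤-trans (term≤sum (adj u) v) (ℕ.≤-reflexive (sym (degree≡sum-adj u)))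

  -- Every adjacency indicator splits according to which endpoint is smaller. Exchanging the order
  -- of summation shows that both parts count the edge list.
  handshake : ℕΣ.sum degree ≡ size ℕ.+ size
  handshake = begin
    ℕΣ.sum degree
      ≡⟨ ℕΣ.sum-cong-≗ degree≡sum-adj ⟩
    ℕΣ.sum (λ u → ℕΣ.sum (adj u))
      ≡⟨ ℕΣ.sum-cong-≗ (λ u → trans (ℕΣ.sum-cong-≗ (adj-split u)) (ℕΣ.∑-distrib-+ (edge u) (λ v → edge v u))) ⟩
    ℕΣ.sum (λ u → ℕΣ.sum (edge u) ℕ.+ ℕΣ.sum (λ v → edge v u))
      ≡⟨ ℕΣ.∑-distrib-+ (λ u → ℕΣ.sum (edge u)) _ ⟩
    ℕΣ.sum (λ u → ℕΣ.sum (edge u)) ℕ.+ ℕΣ.sum (λ u → ℕΣ.sum (λ v → edge v u))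
      ≡⟨ cong (ℕΣ.sum (λ u → ℕΣ.sum (edge u)) ℕ.+_) (ℕΣ.∑-comm (λ u v → edge v u)) ⟩
    ℕΣ.sum (λ u → ℕΣ.sum (edge u)) ℕ.+ ℕΣ.sum (λ u → ℕΣ.sum (edge u))
      ≡⟨ cong₂ ℕ._+_ size≡ size≡ ⟨
    size ℕ.+ size ∎
    where
    open ≡-Reasoning
    edge? : ∀ u v → Dec (u Fin.< v × u ~ v)
    edge? u v = (u Fin.<? v) ×-dec (u ~? v)

    edge : Vertex → Vertex → ℕ
    edge u v = 𝟙 (edge? u v)

    size≡ : size ≡ ℕΣ.sum (λ u → ℕΣ.sum (edge u))
    size≡ = trans (length-filter-cartesianProduct (λ (u , v) → edge? u v) id (allFin order))
      (ℕΣ.sum-cong-≗ λ u → length-filter-tabulate (edge? u) id)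

    adj-split : ∀ u v → adj u v ≡ edge u v ℕ.+ edge v u
    adj-split u v with u ~? v
    -- Abstracting `u ~? v` also rewrites it inside `edge? u v`, which therefore appears here with
    -- the decided value; `edge? v u` stays intact.
    ... | no u≁v  = sym (cong₂ ℕ._+_ (𝟙-no (u Fin.<? v ×-dec no u≁v) (u≁v ∘ proj₂))
                                     (𝟙-no (edge? v u) (u≁v ∘ ~-sym ∘ proj₂)))
    ... | yes u~v with Fin.<-cmp u v
    ...   | tri< u<v _ v≮u = sym (cong₂ ℕ._+_
      (𝟙-yes (u Fin.<? v ×-dec yes u~v) (u<v , u~v)) (𝟙-no (edge? v u) (v≮u ∘ proj₁)))
    ...   | tri> u≮v _ v<u = sym (cong₂ ℕ._+_
      (𝟙-no (u Fin.<? v ×-dec yes u~v) (u≮v ∘ proj₁)) (𝟙-yes (edge? v u) (v<u , ~-sym u~v)))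
    ...   | tri≈ _ refl _  = contradiction u~v ~-irr

  -- Degree sums over neighbourhoods and the weight inequality

  weight : Vertex → ℕ
  weight u = 1 ℕ.⊔ degree u

  -- A neighbour of `u` has degree at least 1, and there the floor 1 in `weight` has no effect.
  sum-adj-weight : ∀ u → ℕΣ.sum (λ w → adj u w ℕ.* weight w) ≡ ℕΣ.sum (λ w → adj u w ℕ.* degree w)
  sum-adj-weight u = ℕΣ.sum-cong-≗ λ w → step w (u ~? w)
    where
    -- The decision is an argument so that matching on it reduces the indicators on both sides.
    step : ∀ w (u~?w : Dec (u ~ w)) → 𝟙 u~?w ℕ.* weight w ≡ 𝟙 u~?w ℕ.* degree w
    step w (no _)    = refl
    step w (yes u~w) = cong (1 ℕ.*_) (ℕ.m≤n⇒m⊔n≡n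
      (subst (ℕ._≤ degree w) (𝟙-yes (w ~? u) (~-sym u~w)) (adj≤degree w u)))

  S : Vertex → ℕ
  S u = ℕΣ.sum (λ w → adj u w ℕ.* degree w)

  -- The vertex `u` and its neighbours are distinct, so their degrees form part of the total degree.
  S+degree≤2size : ∀ u → S u ℕ.+ degree u ℕ.≤ size ℕ.+ size
  S+degree≤2size u = begin
    S u ℕ.+ degree u
      ≡⟨ cong (S u ℕ.+_) (sum-𝟙≡ u degree) ⟨
    S u ℕ.+ ℕΣ.sum (λ w → 𝟙 (u Fin.≟ w) ℕ.* degree w)
      ≡⟨ ℕΣ.∑-distrib-+ _ (λ w → 𝟙 (u Fin.≟ w) ℕ.* degree w) ⟨
    ℕΣ.sum (λ w → adj u w ℕ.* degree w ℕ.+ 𝟙 (u Fin.≟ w) ℕ.* degree w)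
      ≤⟨ sum-mono-≤ (λ w → step w (u ~? w) (u Fin.≟ w)) ⟩
    ℕΣ.sum degree
      ≡⟨ handshake ⟩
    size ℕ.+ size ∎
    where
    open ℕ.≤-Reasoning
    step : ∀ w (u~?w : Dec (u ~ w)) (u≟w : Dec (u ≡ w)) →
           𝟙 u~?w ℕ.* degree w ℕ.+ 𝟙 u≟w ℕ.* degree w ℕ.≤ degree w
    step w (yes u~u) (yes refl) = contradiction u~u ~-irr
    step w (yes _)   (no _)     = ℕ.≤-reflexive (trans (ℕ.+-identityʳ _) (ℕ.+-identityʳ _))
    step w (no _)    (yes _)    = ℕ.≤-reflexive (ℕ.+-identityʳ _)
    step w (no _)    (no _)     = z≤n

  -- Expand the degree of `w` as a sum of `adj w x`. For a neighbour `x` of `u` this term is paid by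
  -- `adj u x`, for any other `x` by `degree x`. At `x = w` the term vanishes, which frees the extra
  -- unit.
  S+neighbourDegree<2size+degree : ∀ u w → u ~ w → S u ℕ.+ degree w ℕ.+ 1 ℕ.≤ size ℕ.+ size ℕ.+ degree u
  S+neighbourDegree<2size+degree u w u~w = begin
    S u ℕ.+ degree w ℕ.+ 1
      ≡⟨ cong₂ (λ a b → S u ℕ.+ a ℕ.+ b) (degree≡sum-adj w) (sym (sum-𝟙≡ w (λ _ → 1))) ⟩
    S u ℕ.+ ℕΣ.sum (adj w) ℕ.+ ℕΣ.sum (λ x → 𝟙 (w Fin.≟ x) ℕ.* 1)
      ≡⟨ trans (ℕΣ.∑-distrib-+ (λ x → adj u x ℕ.* degree x ℕ.+ adj w x) _)
           (cong (ℕ._+ ℕΣ.sum (λ x → 𝟙 (w Fin.≟ x) ℕ.* 1)) (ℕΣ.∑-distrib-+ _ (adj w))) ⟨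
    ℕΣ.sum (λ x → adj u x ℕ.* degree x ℕ.+ adj w x ℕ.+ 𝟙 (w Fin.≟ x) ℕ.* 1)
      ≤⟨ sum-mono-≤ (λ x → step x (u ~? x) (w Fin.≟ x)) ⟩
    ℕΣ.sum (λ x → degree x ℕ.+ adj u x)
      ≡⟨ ℕΣ.∑-distrib-+ degree (adj u) ⟩
    ℕΣ.sum degree ℕ.+ ℕΣ.sum (adj u)
      ≡⟨ cong₂ ℕ._+_ handshake (sym (degree≡sum-adj u)) ⟩
    size ℕ.+ size ℕ.+ degree u ∎
    where
    open ℕ.≤-Reasoning
    step : ∀ x (u~?x : Dec (u ~ x)) (w≟x : Dec (w ≡ x)) →
           𝟙 u~?x ℕ.* degree x ℕ.+ adj w x ℕ.+ 𝟙 w≟x ℕ.* 1 ℕ.≤ degree x ℕ.+ 𝟙 u~?x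
    step x (yes _)   (yes refl) = ℕ.≤-reflexive (cong (ℕ._+ 1) (trans
      (cong₂ ℕ._+_ (ℕ.+-identityʳ (degree x)) (𝟙-no (x ~? x) ~-irr)) (ℕ.+-identityʳ (degree x))))
    step x (yes _)   (no _)     = ℕ.≤-trans
      (ℕ.≤-reflexive (trans (ℕ.+-identityʳ _) (cong (ℕ._+ adj w x) (ℕ.+-identityʳ (degree x)))))
      (ℕ.+-monoʳ-≤ (degree x) (𝟙≤1 (w ~? x)))
    step x (no u≁x)  (yes refl) = contradiction u~w u≁x
    step x (no _)    (no _)     = ℕ.+-monoˡ-≤ 0 (subst (ℕ._≤ degree x) (adj-sym x w) (adj≤degree x w))

  sum-adj-* : ∀ u c → ℕΣ.sum (λ w → adj u w ℕ.* c) ≡ degree u ℕ.* c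
  sum-adj-* u c = trans (sym (ℕΣ.*-distribʳ-sum c (adj u))) (cong (ℕ._* c) (sym (degree≡sum-adj u)))

  module _ {D : ℕ} (degree≤D : ∀ u → degree u ℕ.≤ D) where

    S≤degree*D : ∀ u → S u ℕ.≤ degree u ℕ.* D
    S≤degree*D u = ℕ.≤-trans (sum-mono-≤ (λ w → ℕ.*-monoʳ-≤ (adj u w) (degree≤D w)))
      (ℕ.≤-reflexive (sum-adj-* u D))

    S<degree*D : ∀ u w → u ~ w → degree w ℕ.< D → S u ℕ.+ 1 ℕ.≤ degree u ℕ.* D
    S<degree*D u w u~w dw<D = begin
      S u ℕ.+ 1
        ≡⟨ cong (S u ℕ.+_) (sum-𝟙≡ w (λ _ → 1)) ⟨
      S u ℕ.+ ℕΣ.sum (λ x → 𝟙 (w Fin.≟ x) ℕ.* 1)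
        ≡⟨ ℕΣ.∑-distrib-+ _ (λ x → 𝟙 (w Fin.≟ x) ℕ.* 1) ⟨
      ℕΣ.sum (λ x → adj u x ℕ.* degree x ℕ.+ 𝟙 (w Fin.≟ x) ℕ.* 1)
        ≤⟨ sum-mono-≤ (λ x → step x (w Fin.≟ x)) ⟩
      ℕΣ.sum (λ x → adj u x ℕ.* D)
        ≡⟨ sum-adj-* u D ⟩
      degree u ℕ.* D ∎
      where
      open ℕ.≤-Reasoning
      step : ∀ x (w≟x : Dec (w ≡ x)) → adj u x ℕ.* degree x ℕ.+ 𝟙 w≟x ℕ.* 1 ℕ.≤ adj u x ℕ.* D
      step x (no _)     = ℕ.≤-trans (ℕ.≤-reflexive (ℕ.+-identityʳ _)) (ℕ.*-monoʳ-≤ (adj u x) (degree≤D x))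
      step x (yes refl) rewrite 𝟙-yes (u ~? x) u~w | ℕ.+-identityʳ (degree x) | ℕ.+-identityʳ D
                              | ℕ.+-comm (degree x) 1 = dw<D

    module _ {k : ℕ} (size≡ : size ≡ D ℕ.+ k ℕ.+ 1) (2k+4≤D : 2 ℕ.* k ℕ.+ 4 ℕ.≤ D) where

      weight-gap : ∀ u →
        weight u ℕ.* degree u ℕ.+ ℕΣ.sum (λ w → adj u w ℕ.* weight w) ℕ.+ 1 ℕ.≤ weight u ℕ.* (D ℕ.+ 2)
      weight-gap u = subst (λ s → weight u ℕ.* degree u ℕ.+ s ℕ.+ 1 ℕ.≤ weight u ℕ.* (D ℕ.+ 2))
        (sym (sum-adj-weight u)) (cases (degree u) refl)
        where
        open ℕ.≤-Reasoning
        cases : ∀ d → degree u ≡ d → (1 ℕ.⊔ d) ℕ.* d ℕ.+ S u ℕ.+ 1 ℕ.≤ (1 ℕ.⊔ d) ℕ.* (D ℕ.+ 2)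
        cases 0 d≡ = begin
          S u ℕ.+ 1            ≤⟨ ℕ.+-monoˡ-≤ 1 (subst (λ d → S u ℕ.≤ d ℕ.* D) d≡ (S≤degree*D u)) ⟩
          1                    ≤⟨ ℕ.m≤n+m 1 (D ℕ.+ 1) ⟩
          D ℕ.+ 1 ℕ.+ 1        ≡⟨ identity D ⟩
          1 ℕ.* (D ℕ.+ 2)      ∎
          where
          identity : ∀ D → D ℕ.+ 1 ℕ.+ 1 ≡ 1 ℕ.* (D ℕ.+ 2)
          identity = solve-∀
        -- Here the estimate is tight: the bound `S u ≤ D` gives exactly `D + 2`.
        cases 1 d≡ = begin
          1 ℕ.+ S u ℕ.+ 1
            ≤⟨ ℕ.+-monoˡ-≤ 1 (ℕ.+-monoʳ-≤ 1 (subst (λ d → S u ℕ.≤ d ℕ.* D) d≡ (S≤degree*D u))) ⟩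
          1 ℕ.+ 1 ℕ.* D ℕ.+ 1    ≡⟨ identity D ⟩
          1 ℕ.* (D ℕ.+ 2)        ∎
          where
          identity : ∀ D → 1 ℕ.+ 1 ℕ.* D ℕ.+ 1 ≡ 1 ℕ.* (D ℕ.+ 2)
          identity = solve-∀
        -- The bound `S u ≤ 2 D` alone misses by one. Either the neighbour `w` has degree below `D`
        -- and saves that one, or its large degree enters the count of all edges.
        cases 2 d≡ = split (degree w ℕ.<? D)
          where
          -- The equation `d≡` makes the neighbour list nonempty, so index zero exists.
          i₀ = subst Fin (sym d≡) zero
          w = lookup (neighbours u) i₀
          u~w = lookup-neighbours-~ u i₀
          split : Dec (degree w ℕ.< D) → 4 ℕ.+ S u ℕ.+ 1 ℕ.≤ 2 ℕ.* (D ℕ.+ 2)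
          split (yes dw<D) = begin
            4 ℕ.+ S u ℕ.+ 1      ≡⟨ ℕ.+-assoc 4 (S u) 1 ⟩
            4 ℕ.+ (S u ℕ.+ 1)
              ≤⟨ ℕ.+-monoʳ-≤ 4 (subst (λ d → S u ℕ.+ 1 ℕ.≤ d ℕ.* D) d≡ (S<degree*D u w u~w dw<D)) ⟩
            4 ℕ.+ 2 ℕ.* D        ≡⟨ identity D ⟩
            2 ℕ.* (D ℕ.+ 2)      ∎
            where
            identity : ∀ D → 4 ℕ.+ 2 ℕ.* D ≡ 2 ℕ.* (D ℕ.+ 2)
            identity = solve-∀
          -- Adding `D`, which is at most `degree w`, to the left side makes the edge bound
          -- applicable; `2k + 4 ≤ D` then absorbs the remainder.
          split (no dw≮D) = ℕ.+-cancelʳ-≤ D _ _ (begin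
            4 ℕ.+ S u ℕ.+ 1 ℕ.+ D
              ≤⟨ ℕ.+-monoʳ-≤ _ (ℕ.≮⇒≥ dw≮D) ⟩
            4 ℕ.+ S u ℕ.+ 1 ℕ.+ degree w
              ≡⟨ identity₁ (S u) (degree w) ⟩
            4 ℕ.+ (S u ℕ.+ degree w ℕ.+ 1)
              ≤⟨ ℕ.+-monoʳ-≤ 4 (S+neighbourDegree<2size+degree u w u~w) ⟩
            4 ℕ.+ (size ℕ.+ size ℕ.+ degree u)
              ≡⟨ cong₂ (λ s d → 4 ℕ.+ (s ℕ.+ s ℕ.+ d)) size≡ d≡ ⟩
            4 ℕ.+ (D ℕ.+ k ℕ.+ 1 ℕ.+ (D ℕ.+ k ℕ.+ 1) ℕ.+ 2)
              ≡⟨ identity₂ D k ⟩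
            2 ℕ.* (D ℕ.+ 2) ℕ.+ (2 ℕ.* k ℕ.+ 4)
              ≤⟨ ℕ.+-monoʳ-≤ (2 ℕ.* (D ℕ.+ 2)) 2k+4≤D ⟩
            2 ℕ.* (D ℕ.+ 2) ℕ.+ D ∎)
            where
            identity₁ : ∀ s d → 4 ℕ.+ s ℕ.+ 1 ℕ.+ d ≡ 4 ℕ.+ (s ℕ.+ d ℕ.+ 1)
            identity₁ = solve-∀
            identity₂ : ∀ D k → 4 ℕ.+ (D ℕ.+ k ℕ.+ 1 ℕ.+ (D ℕ.+ k ℕ.+ 1) ℕ.+ 2) ≡
                        2 ℕ.* (D ℕ.+ 2) ℕ.+ (2 ℕ.* k ℕ.+ 4)
            identity₂ = solve-∀
        -- The function d (D + 3 - d) is concave with value 3D at d = 3 and d = D.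
        cases d@(suc (suc (suc i))) d≡ = ℕ.+-cancelʳ-≤ d _ _ (begin
          d ℕ.* d ℕ.+ S u ℕ.+ 1 ℕ.+ d
            ≡⟨ identity₁ d (S u) ⟩
          d ℕ.* d ℕ.+ 1 ℕ.+ (S u ℕ.+ d)
            ≤⟨ ℕ.+-monoʳ-≤ (d ℕ.* d ℕ.+ 1) (subst₂ (λ d s → S u ℕ.+ d ℕ.≤ s ℕ.+ s) d≡ size≡ (S+degree≤2size u)) ⟩
          d ℕ.* d ℕ.+ 1 ℕ.+ (D ℕ.+ k ℕ.+ 1 ℕ.+ (D ℕ.+ k ℕ.+ 1))
            -- One unit is given away to complete `2k + 3` to the `2k + 4` of the hypothesis.
            ≤⟨ ℕ.m≤m+n _ 1 ⟩
          d ℕ.* d ℕ.+ 1 ℕ.+ (D ℕ.+ k ℕ.+ 1 ℕ.+ (D ℕ.+ k ℕ.+ 1)) ℕ.+ 1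
            ≡⟨ identity₂ d D k ⟩
          d ℕ.* d ℕ.+ 2 ℕ.* D ℕ.+ (2 ℕ.* k ℕ.+ 4)
            ≤⟨ ℕ.+-monoʳ-≤ (d ℕ.* d ℕ.+ 2 ℕ.* D) 2k+4≤D ⟩
          d ℕ.* d ℕ.+ 2 ℕ.* D ℕ.+ D
            ≡⟨ cong (λ D → d ℕ.* d ℕ.+ 2 ℕ.* D ℕ.+ D) D≡ ⟩
          d ℕ.* d ℕ.+ 2 ℕ.* (d ℕ.+ j) ℕ.+ (d ℕ.+ j)
            -- With `i = d - 3` and `j = D - d`, the added product is the nonnegative slack
            -- `(d - 3)(D - d)`.
            ≤⟨ ℕ.m≤m+n _ (i ℕ.* j) ⟩
          d ℕ.* d ℕ.+ 2 ℕ.* (d ℕ.+ j) ℕ.+ (d ℕ.+ j) ℕ.+ i ℕ.* j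
            ≡⟨ identity₃ i j ⟩
          d ℕ.* (d ℕ.+ j ℕ.+ 2) ℕ.+ d
            ≡⟨ cong (λ D → d ℕ.* (D ℕ.+ 2) ℕ.+ d) D≡ ⟨
          d ℕ.* (D ℕ.+ 2) ℕ.+ d ∎)
          where
          j = D ∸ d
          D≡ : D ≡ d ℕ.+ j
          D≡ = sym (ℕ.m+[n∸m]≡n (subst (ℕ._≤ D) d≡ (degree≤D u)))
          identity₁ : ∀ d s → d ℕ.* d ℕ.+ s ℕ.+ 1 ℕ.+ d ≡ d ℕ.* d ℕ.+ 1 ℕ.+ (s ℕ.+ d)
          identity₁ = solve-∀
          identity₂ : ∀ d D k → d ℕ.* d ℕ.+ 1 ℕ.+ (D ℕ.+ k ℕ.+ 1 ℕ.+ (D ℕ.+ k ℕ.+ 1)) ℕ.+ 1 ≡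
                      d ℕ.* d ℕ.+ 2 ℕ.* D ℕ.+ (2 ℕ.* k ℕ.+ 4)
          identity₂ = solve-∀
          identity₃ : ∀ i j →
            (3 ℕ.+ i) ℕ.* (3 ℕ.+ i) ℕ.+ 2 ℕ.* ((3 ℕ.+ i) ℕ.+ j) ℕ.+ ((3 ℕ.+ i) ℕ.+ j) ℕ.+ i ℕ.* j ≡
            (3 ℕ.+ i) ℕ.* ((3 ℕ.+ i) ℕ.+ j ℕ.+ 2) ℕ.+ (3 ℕ.+ i)
          identity₃ = solve-∀

-- Rational approximations

-- `ℕ→ℚ` normalises by a gcd that does not reduce for a variable numerator. The laws below pass to
-- unnormalised fractions with denominator 1 instead.
toℚᵘ-ℕ→ℚ : ∀ n → toℚᵘ (ℕ→ℚ n) ℚᵘ.≃ mkℚᵘ (ℤ.+ n) 0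
toℚᵘ-ℕ→ℚ n = ℚ.toℚᵘ-fromℚᵘ (mkℚᵘ (ℤ.+ n) 0)

ℕ→ℚ-homo-+ : ∀ m n → ℕ→ℚ (m ℕ.+ n) ≡ ℕ→ℚ m + ℕ→ℚ n
ℕ→ℚ-homo-+ m n = ℚ.toℚᵘ-injective (begin
  toℚᵘ (ℕ→ℚ (m ℕ.+ n))                  ≈⟨ toℚᵘ-ℕ→ℚ (m ℕ.+ n) ⟩
  mkℚᵘ (ℤ.+ (m ℕ.+ n)) 0
    ≈⟨ *≡* (cong (ℤ._* ℤ.1ℤ) (sym (cong₂ ℤ._+_ (ℤ.*-identityʳ (ℤ.+ m)) (ℤ.*-identityʳ (ℤ.+ n))))) ⟩
  mkℚᵘ (ℤ.+ m) 0 ℚᵘ.+ mkℚᵘ (ℤ.+ n) 0    ≈⟨ ℚᵘ.+-cong (toℚᵘ-ℕ→ℚ m) (toℚᵘ-ℕ→ℚ n) ⟨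
  toℚᵘ (ℕ→ℚ m) ℚᵘ.+ toℚᵘ (ℕ→ℚ n)        ≈⟨ ℚ.toℚᵘ-homo-+ (ℕ→ℚ m) (ℕ→ℚ n) ⟨
  toℚᵘ (ℕ→ℚ m + ℕ→ℚ n)                  ∎)
  where open ℚᵘ.≃-Reasoning

ℕ→ℚ-homo-* : ∀ m n → ℕ→ℚ (m ℕ.* n) ≡ ℕ→ℚ m * ℕ→ℚ n
ℕ→ℚ-homo-* m n = ℚ.toℚᵘ-injective (begin
  toℚᵘ (ℕ→ℚ (m ℕ.* n))                  ≈⟨ toℚᵘ-ℕ→ℚ (m ℕ.* n) ⟩
  mkℚᵘ (ℤ.+ (m ℕ.* n)) 0                ≈⟨ *≡* (cong (ℤ._* ℤ.1ℤ) (ℤ.pos-* m n)) ⟩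
  mkℚᵘ (ℤ.+ m) 0 ℚᵘ.* mkℚᵘ (ℤ.+ n) 0    ≈⟨ ℚᵘ.*-cong (toℚᵘ-ℕ→ℚ m) (toℚᵘ-ℕ→ℚ n) ⟨
  toℚᵘ (ℕ→ℚ m) ℚᵘ.* toℚᵘ (ℕ→ℚ n)        ≈⟨ ℚ.toℚᵘ-homo-* (ℕ→ℚ m) (ℕ→ℚ n) ⟨
  toℚᵘ (ℕ→ℚ m * ℕ→ℚ n)                  ∎)
  where open ℚᵘ.≃-Reasoning

ℕ→ℚ-mono-≤ : ∀ {m n} → m ℕ.≤ n → ℕ→ℚ m ≤ ℕ→ℚ n
ℕ→ℚ-mono-≤ {m} {n} m≤n = ℚ.toℚᵘ-cancel-≤ (begin
  toℚᵘ (ℕ→ℚ m)      ≃⟨ toℚᵘ-ℕ→ℚ m ⟩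
  mkℚᵘ (ℤ.+ m) 0    ≤⟨ *≤* (ℤ.*-monoʳ-≤-nonNeg ℤ.1ℤ (ℤ.+≤+ m≤n)) ⟩
  mkℚᵘ (ℤ.+ n) 0    ≃⟨ toℚᵘ-ℕ→ℚ n ⟨
  toℚᵘ (ℕ→ℚ n)      ∎)
  where open ℚᵘ.≤-Reasoning

ℕ→ℚ-cancel-≤ : ∀ {m n} → ℕ→ℚ m ≤ ℕ→ℚ n → m ℕ.≤ n
ℕ→ℚ-cancel-≤ {m} {n} m≤n = ℤ.drop‿+≤+ (ℤ.*-cancelʳ-≤-pos (ℤ.+ m) (ℤ.+ n) ℤ.1ℤ (ℚᵘ.drop-*≤* (begin
  mkℚᵘ (ℤ.+ m) 0    ≃⟨ toℚᵘ-ℕ→ℚ m ⟨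
  toℚᵘ (ℕ→ℚ m)      ≤⟨ ℚ.toℚᵘ-mono-≤ m≤n ⟩
  toℚᵘ (ℕ→ℚ n)      ≃⟨ toℚᵘ-ℕ→ℚ n ⟩
  mkℚᵘ (ℤ.+ n) 0    ∎)))
  where open ℚᵘ.≤-Reasoning

ℕ→ℚ-homo-∸ : ∀ {m n} → n ℕ.≤ m → ℕ→ℚ (m ∸ n) ≡ ℕ→ℚ m - ℕ→ℚ n
ℕ→ℚ-homo-∸ {m} {n} n≤m = begin
  ℕ→ℚ (m ∸ n)                        ≡⟨ solve 2 (λ a b → a := (a :+ b) :- b) refl (ℕ→ℚ (m ∸ n)) (ℕ→ℚ n) ⟩
  (ℕ→ℚ (m ∸ n) + ℕ→ℚ n) - ℕ→ℚ n      ≡⟨ cong (_- ℕ→ℚ n) (ℕ→ℚ-homo-+ (m ∸ n) n) ⟨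
  ℕ→ℚ (m ∸ n ℕ.+ n) - ℕ→ℚ n          ≡⟨ cong (λ l → ℕ→ℚ l - ℕ→ℚ n) (ℕ.m∸n+n≡m n≤m) ⟩
  ℕ→ℚ m - ℕ→ℚ n                      ∎
  where open ≡-Reasoning

0≤ℕ→ℚ : ∀ n → 0ℚ ≤ ℕ→ℚ n
0≤ℕ→ℚ n = ℕ→ℚ-mono-≤ (z≤n {n})

0<ℕ→ℚ : ∀ {n} → 1 ℕ.≤ n → 0ℚ < ℕ→ℚ n
0<ℕ→ℚ 1≤n = ℚ.<-≤-trans (ℚ.positive⁻¹ 1ℚ) (ℕ→ℚ-mono-≤ 1≤n)

ℕ→ℚ-sum : ∀ {n} (f : Fin n → ℕ) → ℕ→ℚ (ℕΣ.sum f) ≡ ℚΣ.sum (ℕ→ℚ ∘ f)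
ℕ→ℚ-sum {zero}  f = refl
ℕ→ℚ-sum {suc n} f = trans (ℕ→ℚ-homo-+ (f zero) _) (cong (ℕ→ℚ (f zero) +_) (ℕ→ℚ-sum (f ∘ suc)))

ℚ-sum-mono-≤ : ∀ {n} {f g : Fin n → ℚ} → (∀ i → f i ≤ g i) → ℚΣ.sum f ≤ ℚΣ.sum g
ℚ-sum-mono-≤ {zero}  f≤g = ℚ.≤-refl
ℚ-sum-mono-≤ {suc n} f≤g = ℚ.+-mono-≤ (f≤g zero) (ℚ-sum-mono-≤ (f≤g ∘ suc))

∣sum∣≤sum∣∣ : ∀ {n} (f : Fin n → ℚ) → ∣ ℚΣ.sum f ∣ ≤ ℚΣ.sum (∣_∣ ∘ f)
∣sum∣≤sum∣∣ {zero}  f = ℚ.≤-refl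
∣sum∣≤sum∣∣ {suc n} f = ℚ.≤-trans (ℚ.∣p+q∣≤∣p∣+∣q∣ (f zero) _)
  (ℚ.+-monoʳ-≤ ∣ f zero ∣ (∣sum∣≤sum∣∣ (f ∘ suc)))

p≤∣p∣ : ∀ p → p ≤ ∣ p ∣
p≤∣p∣ p with ℚ.≤-total 0ℚ p
... | inj₁ 0≤p = ℚ.≤-reflexive (sym (ℚ.0≤p⇒∣p∣≡p 0≤p))
... | inj₂ p≤0 = ℚ.≤-trans p≤0 (ℚ.0≤∣p∣ p)

reciprocal : ∀ p → 0ℚ < p → ∃[ r ] (0ℚ < r × r * p ≡ 1ℚ)
reciprocal p 0<p = 1/ p , ℚ.positive⁻¹ (1/ p) {{ℚ.1/pos⇒pos p}} , ℚ.*-inverseˡ p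
  where
  instance
    p>0 : ℚ.Positive p
    p>0 = positive 0<p
    p≢0 : ℚ.NonZero p
    p≢0 = ℚ.pos⇒nonZero p

0<p*q : ∀ {p q} → 0ℚ < p → 0ℚ < q → 0ℚ < p * q
0<p*q {p} {q} 0<p 0<q = ℚ.positive⁻¹ (p * q) {{ℚ.pos*pos⇒pos p {{positive 0<p}} q {{positive 0<q}}}}

-- A maximum principle with positive weights

argmax-ratio : ∀ {n} (x p : Fin n → ℚ) → (∀ i → 0ℚ < p i) → Fin n →
  ∃[ u ] (∀ w → x w * p u ≤ x u * p w)
argmax-ratio {n} x p 0<p z = u , cross
  where
  r : Fin n → ℚ
  r i = proj₁ (reciprocal (p i) (0<p i))
  r*p≡1 : ∀ i → r i * p i ≡ 1ℚ
  r*p≡1 i = proj₂ (proj₂ (reciprocal (p i) (0<p i)))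
  ratio : Fin n → ℚ
  ratio i = x i * r i
  open Extrema (DecTotalOrder.totalOrder ℚ.≤-decTotalOrder) using (argmax; f[xs]≤f[argmax])
  -- The given index `z` is the default value of `argmax` and witnesses that the index set is
  -- inhabited.
  u = argmax ratio z (allFin n)
  open ℚ.≤-Reasoning
  cross : ∀ w → x w * p u ≤ x u * p w
  cross w = begin
    x w * p u                  ≡⟨ cong (_* p u) (ℚ.*-identityʳ (x w)) ⟨
    x w * 1ℚ * p u             ≡⟨ cong (λ o → x w * o * p u) (r*p≡1 w) ⟨
    x w * (r w * p w) * p u
      ≡⟨ solve 4 (λ x r p q → x :* (r :* p) :* q := (x :* r) :* (p :* q)) refl (x w) (r w) (p w) (p u) ⟩
    ratio w * (p w * p u)
      ≤⟨ ℚ.*-monoʳ-≤-nonNeg (p w * p u) {{nonNegative (ℚ.<⇒≤ (0<p*q (0<p w) (0<p u)))}}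
                                    (All.lookup (f[xs]≤f[argmax] {f = ratio} z (allFin n)) (∈-allFin w)) ⟩
    ratio u * (p w * p u)
      ≡⟨ solve 4 (λ x r p q → (x :* r) :* (p :* q) := x :* (r :* q) :* p) refl (x u) (r u) (p w) (p u) ⟩
    x u * (r u * p u) * p w    ≡⟨ cong (λ o → x u * o * p w) (r*p≡1 u) ⟩
    x u * 1ℚ * p w             ≡⟨ cong (_* p w) (ℚ.*-identityʳ (x u)) ⟩
    x u * p w                  ∎

-- Let `u` maximise `|x| / p`. Then `c |x u| ≤ δ + Σ A |x w| ≤ δ + (Σ A p) |x u| / p
-- u`, and the gap bounds `Σ A p` by `c p u - γ`. Hence `γ |x u| ≤ δ p u`, and maximality carries
-- this bound over to every `z`.
weighted-max-principle : ∀ {n} (A : Fin n → Fin n → ℚ) (c p x : Fin n → ℚ) {γ δ} → 0ℚ ≤ γ →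
  (∀ u w → 0ℚ ≤ A u w) → (∀ u → 0ℚ < p u) →
  (∀ u → ℚΣ.sum (λ w → A u w * p w) + γ ≤ c u * p u) →
  (∀ u → ∣ c u * x u - ℚΣ.sum (λ w → A u w * x w) ∣ ≤ δ) →
  ∀ z → γ * ∣ x z ∣ ≤ δ * p z
weighted-max-principle A c p x {γ} {δ} 0≤γ 0≤A 0<p gap residual z =
  ℚ.*-cancelʳ-≤-pos P {{positive (0<p u)}} (begin
    γ * ∣ x z ∣ * P      ≡⟨ ℚ.*-assoc γ ∣ x z ∣ P ⟩
    γ * (∣ x z ∣ * P)    ≤⟨ ℚ.*-monoˡ-≤-nonNeg γ {{nonNegative 0≤γ}} (maximal z) ⟩
    γ * (X * p z)        ≡⟨ ℚ.*-assoc γ X (p z) ⟨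
    γ * X * p z          ≤⟨ ℚ.*-monoʳ-≤-nonNeg (p z) {{nonNegative (ℚ.<⇒≤ (0<p z))}} γX≤δP ⟩
    δ * P * p z          ≡⟨ solve 3 (λ d P p → d :* P :* p := d :* p :* P) refl δ P (p z) ⟩
    δ * p z * P          ∎)
  where
  open ℚ.≤-Reasoning
  maximum = argmax-ratio (∣_∣ ∘ x) p 0<p z
  u = proj₁ maximum
  maximal = proj₂ maximum
  P = p u
  X = ∣ x u ∣
  T = ℚΣ.sum (λ w → A u w * x w)
  s = ℚΣ.sum (λ w → A u w * p w)

  0≤P : ℚ.NonNegative P
  0≤P = nonNegative (ℚ.<⇒≤ (0<p u))

  term : ∀ w → ∣ A u w * x w ∣ * P ≤ A u w * p w * X
  term w = begin
    ∣ A u w * x w ∣ * P        ≡⟨ cong (_* P) (ℚ.∣p*q∣≡∣p∣*∣q∣ (A u w) (x w)) ⟩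
    ∣ A u w ∣ * ∣ x w ∣ * P    ≡⟨ cong (λ a → a * ∣ x w ∣ * P) (ℚ.0≤p⇒∣p∣≡p (0≤A u w)) ⟩
    A u w * ∣ x w ∣ * P        ≡⟨ ℚ.*-assoc (A u w) ∣ x w ∣ P ⟩
    A u w * (∣ x w ∣ * P)      ≤⟨ ℚ.*-monoˡ-≤-nonNeg (A u w) {{nonNegative (0≤A u w)}} (maximal w) ⟩
    A u w * (X * p w)          ≡⟨ solve 3 (λ a X p → a :* (X :* p) := a :* p :* X) refl (A u w) X (p w) ⟩
    A u w * p w * X            ∎

  ∣T∣P≤sX : ∣ T ∣ * P ≤ s * X
  ∣T∣P≤sX = begin
    ∣ T ∣ * P
      ≤⟨ ℚ.*-monoʳ-≤-nonNeg P {{0≤P}} (∣sum∣≤sum∣∣ (λ w → A u w * x w)) ⟩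
    ℚΣ.sum (λ w → ∣ A u w * x w ∣) * P         ≡⟨ ℚΣ.*-distribʳ-sum P (λ w → ∣ A u w * x w ∣) ⟩
    ℚΣ.sum (λ w → ∣ A u w * x w ∣ * P)         ≤⟨ ℚ-sum-mono-≤ term ⟩
    ℚΣ.sum (λ w → A u w * p w * X)             ≡⟨ ℚΣ.*-distribʳ-sum X (λ w → A u w * p w) ⟨
    s * X                                      ∎

  cX≤δ+∣T∣ : c u * X ≤ δ + ∣ T ∣
  cX≤δ+∣T∣ = begin
    -- Passing to `|c u|` avoids a discussion of the sign of `c u`.
    c u * X                            ≤⟨ ℚ.*-monoʳ-≤-nonNeg X {{ℚ.∣-∣-nonNeg (x u)}} (p≤∣p∣ (c u)) ⟩
    ∣ c u ∣ * X                        ≡⟨ ℚ.∣p*q∣≡∣p∣*∣q∣ (c u) (x u) ⟨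
    ∣ c u * x u ∣
      ≡⟨ cong ∣_∣ (solve 2 (λ a b → a := (a :- b) :+ b) refl (c u * x u) T) ⟩
    ∣ (c u * x u - T) + T ∣            ≤⟨ ℚ.∣p+q∣≤∣p∣+∣q∣ (c u * x u - T) T ⟩
    ∣ c u * x u - T ∣ + ∣ T ∣          ≤⟨ ℚ.+-monoˡ-≤ ∣ T ∣ (residual u) ⟩
    δ + ∣ T ∣                          ∎

  γX≤δP : γ * X ≤ δ * P
  γX≤δP = begin
    γ * X                              ≡⟨ solve 3 (λ g X s → g :* X := (s :+ g) :* X :- s :* X) refl γ X s ⟩
    (s + γ) * X - s * X
      ≤⟨ ℚ.+-monoˡ-≤ (ℚ.- (s * X)) (ℚ.*-monoʳ-≤-nonNeg X {{ℚ.∣-∣-nonNeg (x u)}} (gap u)) ⟩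
    c u * P * X - s * X
      ≡⟨ cong (_- s * X) (solve 3 (λ c P X → c :* P :* X := c :* X :* P) refl (c u) P X) ⟩
    c u * X * P - s * X
      ≤⟨ ℚ.+-monoˡ-≤ (ℚ.- (s * X)) (ℚ.*-monoʳ-≤-nonNeg P {{0≤P}} cX≤δ+∣T∣) ⟩
    (δ + ∣ T ∣) * P - s * X            ≡⟨ cong (_- s * X) (ℚ.*-distribʳ-+ P δ ∣ T ∣) ⟩
    δ * P + ∣ T ∣ * P - s * X          ≤⟨ ℚ.+-monoˡ-≤ (ℚ.- (s * X)) (ℚ.+-monoʳ-≤ (δ * P) ∣T∣P≤sX) ⟩
    δ * P + s * X - s * X              ≡⟨ solve 2 (λ a b → a :+ b :- b := a) refl (δ * P) (s * X) ⟩
    δ * P                              ∎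

-- Eigenvector equations read on approximating sequences

eventually-all : ∀ {n} {P : Fin n → ℕ → Set} →
  (∀ u → ∃[ N ] (∀ i → N ℕ.≤ i → P u i)) → ∃[ N ] (∀ i → N ℕ.≤ i → ∀ u → P u i)
eventually-all {zero}  _ = 0 , λ _ _ ()
eventually-all {suc n} h =
  let N₀ , h₀ = h zero
      N₁ , h₁ = eventually-all (h ∘ suc)
  in N₀ ℕ.⊔ N₁ , λ where
    i N≤i zero    → h₀ i (ℕ.m⊔n≤o⇒m≤o N₀ N₁ N≤i)
    i N≤i (suc u) → h₁ i (ℕ.m⊔n≤o⇒n≤o N₀ N₁ N≤i) u

seq-∑ : ∀ {n} (f : Fin n → ℝ) i → seq (∑ f) i ≡ ℚΣ.sum (λ j → seq (f j) i)
seq-∑ {zero}  f i = refl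
seq-∑ {suc n} f i = cong (seq (f zero) i +_) (seq-∑ (f ∘ suc) i)

module _ {n : ℕ} (M : Matrix n) (d : Fin n → ℕ) (a : Fin n → Fin n → ℕ)
         (entries : ∀ u w i → seq (M u w) i ≡ ℕ→ℚ (𝟙 (u Fin.≟ w) ℕ.* d u) + ℕ→ℚ (a u w))
         where

  sum-diagonal : ∀ u (x : Fin n → ℚ) →
    ℚΣ.sum (λ w → ℕ→ℚ (𝟙 (u Fin.≟ w) ℕ.* d u) * x w) ≡ ℕ→ℚ (d u) * x u
  sum-diagonal u x = trans (sum-supported-at ℚ.+-0-monoid diagonal u off-diagonal) on-diagonal
    where
    diagonal : Fin n → ℚ
    diagonal w = ℕ→ℚ (𝟙 (u Fin.≟ w) ℕ.* d u) * x w
    off-diagonal : ∀ w → u ≢ w → diagonal w ≡ 0ℚ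
    off-diagonal w u≢w = trans (cong (λ o → ℕ→ℚ (o ℕ.* d u) * x w) (𝟙-no (u Fin.≟ w) u≢w)) (ℚ.*-zeroˡ (x w))
    on-diagonal : diagonal u ≡ ℕ→ℚ (d u) * x u
    on-diagonal = cong (λ o → ℕ→ℚ o * x u)
      (trans (cong (ℕ._* d u) (𝟙-yes (u Fin.≟ u) refl)) (ℕ.*-identityˡ (d u)))

  seq-· : ∀ (v : Fin n → ℝ) u i → seq ((M · v) u) i ≡
    ℕ→ℚ (d u) * seq (v u) i + ℚΣ.sum (λ w → ℕ→ℚ (a u w) * seq (v w) i)
  seq-· v u i = begin
    seq ((M · v) u) i
      ≡⟨ seq-∑ (λ w → M u w *ℝ v w) i ⟩
    ℚΣ.sum (λ w → seq (M u w) i * x w)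
      ≡⟨ ℚΣ.sum-cong-≗ (λ w → trans (cong (_* x w) (entries u w i))
                                    (ℚ.*-distribʳ-+ (x w) (diag w) (ℕ→ℚ (a u w)))) ⟩
    ℚΣ.sum (λ w → diag w * x w + ℕ→ℚ (a u w) * x w)
      ≡⟨ ℚΣ.∑-distrib-+ (λ w → diag w * x w) (λ w → ℕ→ℚ (a u w) * x w) ⟩
    ℚΣ.sum (λ w → diag w * x w) + ℚΣ.sum (λ w → ℕ→ℚ (a u w) * x w)
      ≡⟨ cong (_+ ℚΣ.sum (λ w → ℕ→ℚ (a u w) * x w)) (sum-diagonal u x) ⟩
    ℕ→ℚ (d u) * x u + ℚΣ.sum (λ w → ℕ→ℚ (a u w) * x w) ∎
    where
    open ≡-Reasoning
    x diag : Fin n → ℚ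
    x w = seq (v w) i
    diag w = ℕ→ℚ (𝟙 (u Fin.≟ w) ℕ.* d u)

  module _ {T : ℕ} (p : Fin n → ℕ) (1≤p : ∀ u → 1 ℕ.≤ p u) (p≤T : ∀ u → p u ℕ.≤ T)
           (gap : ∀ u → p u ℕ.* d u ℕ.+ ℕΣ.sum (λ w → a u w ℕ.* p w) ℕ.+ 1 ℕ.≤ p u ℕ.* T)
           (q : ℝ) (T≤q : ℕ→ℝ T ≤ℝ q)
           where

    -- At every late index `i` the rational vector of approximations satisfies the eigenvector
    -- equation up to `δ`, while `q` exceeds `T - η`. The maximum principle with gap `½` then bounds
    -- the coordinate at `z`.
    eigenvector≃0 : (v : Fin n → ℝ) → (∀ u → (M · v) u ≃ q *ℝ v u) → ∀ z → v z ≃ 0ℝ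
    eigenvector≃0 v Mv≃qv z ε 0<ε = N₁ ℕ.⊔ N₂ , λ i N≤i → small i
        (bound₁ i (ℕ.m⊔n≤o⇒m≤o N₁ N₂ N≤i)) (bound₂ i (ℕ.m⊔n≤o⇒n≤o N₁ N₂ N≤i))
      where
      open ℚ.≤-Reasoning
      ½<1 : ½ < 1ℚ
      ½<1 = toWitness {a? = ½ ℚ.<? 1ℚ} _
      0<½ : 0ℚ < ½
      0<½ = ℚ.positive⁻¹ ½
      P : Fin n → ℚ
      P u = ℕ→ℚ (p u)
      A : Fin n → Fin n → ℚ
      A u w = ℕ→ℚ (a u w)
      1/T = reciprocal (ℕ→ℚ T) (0<ℕ→ℚ (ℕ.≤-trans (1≤p z) (p≤T z)))
      1/P = reciprocal (P z) (0<ℕ→ℚ (1≤p z))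
      -- An error `η = 1/(2T)` in `q`, multiplied by a weight of at most `T`, costs at most half of
      -- the integral gap 1.
      η = ½ * proj₁ 1/T
      -- Chosen so that `δ p z = ε/4`; the principle then yields `½ |x z| ≤ ε/4`, strictly below
      -- `ε/2`.
      δ = ½ * (½ * ε) * proj₁ 1/P
      0<η : 0ℚ < η
      0<η = 0<p*q 0<½ (proj₁ (proj₂ 1/T))
      0<δ : 0ℚ < δ
      0<δ = 0<p*q (0<p*q 0<½ (0<p*q 0<½ 0<ε)) (proj₁ (proj₂ 1/P))

      N₁ = proj₁ (T≤q η 0<η)
      bound₁ = proj₂ (T≤q η 0<η)
      N₂ = proj₁ (eventually-all λ u → Mv≃qv u δ 0<δ)
      bound₂ = proj₂ (eventually-all λ u → Mv≃qv u δ 0<δ)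

      module _ (i : ℕ) (T<q+η : ℕ→ℚ T < seq q i + η)
               (residual : ∀ u → ∣ seq ((M · v) u) i - seq q i * seq (v u) i ∣ < δ) where
        x : Fin n → ℚ
        x u = seq (v u) i
        -- The diagonal of `M` is moved to the side of the eigenvalue, which leaves the nonnegative
        -- matrix `A`.
        c : Fin n → ℚ
        c u = seq q i - ℕ→ℚ (d u)

        PT≤Pq+½ : ∀ u → P u * ℕ→ℚ T ≤ P u * seq q i + ½
        PT≤Pq+½ u = begin
          P u * ℕ→ℚ T
            ≤⟨ ℚ.*-monoˡ-≤-nonNeg (P u) {{nonNegative (0≤ℕ→ℚ (p u))}} (ℚ.<⇒≤ T<q+η) ⟩
          P u * (seq q i + η)                  ≡⟨ ℚ.*-distribˡ-+ (P u) (seq q i) η ⟩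
          P u * seq q i + P u * η
            ≤⟨ ℚ.+-monoʳ-≤ (P u * seq q i) (ℚ.*-monoʳ-≤-nonNeg η {{nonNegative (ℚ.<⇒≤ 0<η)}} (ℕ→ℚ-mono-≤ (p≤T u))) ⟩
          P u * seq q i + ℕ→ℚ T * η
            ≡⟨ cong (P u * seq q i +_) (solve 3 (λ T h r → T :* (h :* r) := h :* (r :* T))
                 refl (ℕ→ℚ T) ½ (proj₁ 1/T)) ⟩
          P u * seq q i + ½ * (proj₁ 1/T * ℕ→ℚ T)
            ≡⟨ cong (λ o → P u * seq q i + ½ * o) (proj₂ (proj₂ 1/T)) ⟩
          P u * seq q i + ½ * 1ℚ               ≡⟨ cong (P u * seq q i +_) (ℚ.*-identityʳ ½) ⟩
          P u * seq q i + ½                    ∎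

        gapℚ : ∀ u → P u * ℕ→ℚ (d u) + ℚΣ.sum (λ w → A u w * P w) + 1ℚ ≤ P u * ℕ→ℚ T
        gapℚ u = begin
          P u * ℕ→ℚ (d u) + ℚΣ.sum (λ w → A u w * P w) + 1ℚ
            ≡⟨ cong₂ (λ a b → a + b + 1ℚ) (ℕ→ℚ-homo-* (p u) (d u))
                 (trans (ℕ→ℚ-sum (λ w → a u w ℕ.* p w)) (ℚΣ.sum-cong-≗ (λ w → ℕ→ℚ-homo-* (a u w) (p w)))) ⟨
          ℕ→ℚ (p u ℕ.* d u) + ℕ→ℚ s + 1ℚ
            ≡⟨ trans (ℕ→ℚ-homo-+ (p u ℕ.* d u ℕ.+ s) 1) (cong (_+ 1ℚ) (ℕ→ℚ-homo-+ (p u ℕ.* d u) s)) ⟨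
          ℕ→ℚ (p u ℕ.* d u ℕ.+ s ℕ.+ 1)
            ≤⟨ ℕ→ℚ-mono-≤ (gap u) ⟩
          ℕ→ℚ (p u ℕ.* T)
            ≡⟨ ℕ→ℚ-homo-* (p u) T ⟩
          P u * ℕ→ℚ T ∎
          where s = ℕΣ.sum (λ w → a u w ℕ.* p w)

        half-gap : ∀ u → ℚΣ.sum (λ w → A u w * P w) + ½ ≤ c u * P u
        half-gap u = begin
          s + ½
            -- At `h = ½` the term `h + h` computes to `1ℚ`.
            ≡⟨ solve 4 (λ P d s h → s :+ h := (P :* d :+ s :+ (h :+ h)) :- (P :* d :+ h))
                 refl (P u) dᵤ s ½ ⟩
          (P u * dᵤ + s + 1ℚ) - (P u * dᵤ + ½)
            ≤⟨ ℚ.+-monoˡ-≤ (ℚ.- (P u * dᵤ + ½)) (ℚ.≤-trans (gapℚ u) (PT≤Pq+½ u)) ⟩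
          (P u * seq q i + ½) - (P u * dᵤ + ½)
            ≡⟨ solve 4 (λ P q d h → (P :* q :+ h) :- (P :* d :+ h) := (q :- d) :* P)
                 refl (P u) (seq q i) dᵤ ½ ⟩
          c u * P u                                      ∎
          where
          s = ℚΣ.sum (λ w → A u w * P w)
          dᵤ = ℕ→ℚ (d u)

        residual′ : ∀ u → ∣ c u * x u - ℚΣ.sum (λ w → A u w * x w) ∣ ≤ δ
        residual′ u = begin
          ∣ c u * x u - s ∣                                     ≡⟨ ℚ.∣-p∣≡∣p∣ (c u * x u - s) ⟨
          ∣ ℚ.- (c u * x u - s) ∣
            ≡⟨ cong ∣_∣ (solve 4 (λ q d x s → :- ((q :- d) :* x :- s) := (d :* x :+ s) :- q :* x)
                 refl (seq q i) (ℕ→ℚ (d u)) (x u) s) ⟩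
          ∣ (ℕ→ℚ (d u) * x u + s) - seq q i * x u ∣
            ≡⟨ cong (λ y → ∣ y - seq q i * x u ∣) (seq-· v u i) ⟨
          ∣ seq ((M · v) u) i - seq q i * x u ∣ <⟨ residual u ⟩
          δ                                                     ∎
          where s = ℚΣ.sum (λ w → A u w * x w)

        small : ∣ x z - 0ℚ ∣ < ε
        small = ℚ.*-cancelˡ-<-nonNeg ½ (begin-strict
          ½ * ∣ x z - 0ℚ ∣                            ≡⟨ cong (λ y → ½ * ∣ y ∣) (ℚ.+-identityʳ (x z)) ⟩
          ½ * ∣ x z ∣
            ≤⟨ weighted-max-principle A c P x (ℚ.<⇒≤ 0<½) (λ u w → 0≤ℕ→ℚ (a u w))
                                                          (λ u → 0<ℕ→ℚ (1≤p u)) half-gap residual′ z ⟩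
          ½ * (½ * ε) * proj₁ 1/P * P z               ≡⟨ ℚ.*-assoc (½ * (½ * ε)) (proj₁ 1/P) (P z) ⟩
          ½ * (½ * ε) * (proj₁ 1/P * P z)             ≡⟨ cong (½ * (½ * ε) *_) (proj₂ (proj₂ 1/P)) ⟩
          ½ * (½ * ε) * 1ℚ                            ≡⟨ ℚ.*-identityʳ (½ * (½ * ε)) ⟩
          ½ * (½ * ε)
            <⟨ ℚ.*-monoˡ-<-pos (½ * ε) {{positive (0<p*q 0<½ 0<ε)}} {½} {1ℚ} ½<1 ⟩
          1ℚ * (½ * ε)                                ≡⟨ ℚ.*-identityˡ (½ * ε) ⟩
          ½ * ε                                       ∎)

    not-eigenvalue : ¬ IsEigenvalue M q
    not-eigenvalue (v , v≄0 , Mv≃qv) = v≄0 (eigenvector≃0 v Mv≃qv)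

-- Application to the signless Laplacian

module _ (G : Graph) where
  open Graph G

  -- Both sides branch on the same Boolean, so it is generalised and split.
  seq-degreeMatrix : ∀ u w i → seq (degreeMatrix u w) i ≡ ℕ→ℚ (𝟙 (u Fin.≟ w) ℕ.* degree u)
  seq-degreeMatrix u w i = entry (does (u Fin.≟ w))
    where
    entry : ∀ b → seq (if b then ℕ→ℝ (degree u) else 0ℝ) i ≡ ℕ→ℚ ((if b then 1 else 0) ℕ.* degree u)
    entry true  = cong ℕ→ℚ (sym (ℕ.+-identityʳ (degree u)))
    entry false = refl

  seq-adjacencyMatrix : ∀ u w i → seq (adjacencyMatrix u w) i ≡ ℕ→ℚ (adj G u w)
  seq-adjacencyMatrix u w i = entry (does (u ~? w))
    where
    entry : ∀ b → seq (if b then 1ℝ else 0ℝ) i ≡ ℕ→ℚ (if b then 1 else 0)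
    entry true  = refl
    entry false = refl

  seq-signlessLaplacian : ∀ u w i →
    seq (signlessLaplacian u w) i ≡ ℕ→ℚ (𝟙 (u Fin.≟ w) ℕ.* degree u) + ℕ→ℚ (adj G u w)
  seq-signlessLaplacian u w i = cong₂ _+_ (seq-degreeMatrix u w i) (seq-adjacencyMatrix u w i)

theorem1p6 : (k m : ℕ) (G : Graph) → Graph.size G ≡ m →
    (½ * (ℕ→ℚ k * ℕ→ℚ k) + ℕ→ℚ 6 * ℕ→ℚ k + ℕ→ℚ 3) ⊔ (ℕ→ℚ 7 * ℕ→ℚ k + ℕ→ℚ 25) ≤ ℕ→ℚ m →
    (q : ℝ) → IsSignlessLaplacianSpectralRadius G q →
    (ℕ→ℝ m -ℝ ℕ→ℝ k) +ℝ 1ℝ ≤ℝ q →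
    G ContainsSubgraph (K₁, (m ∸ k))
theorem1p6 k m G size≡m max≤m q (eigenvalue , _) m-k+1≤q =
  -- The search over the finitely many vertices is decidable, so the case distinction is
  -- constructive.
  conclude (Fin.any? (λ u → m ∸ k ℕ.≤? Graph.degree G u))
  where
  open Graph G using (degree; size)
  D = m ∸ suc k

  7k+25≤m : 7 ℕ.* k ℕ.+ 25 ℕ.≤ m
  7k+25≤m = ℕ→ℚ-cancel-≤ (begin
    ℕ→ℚ (7 ℕ.* k ℕ.+ 25)
      ≡⟨ trans (ℕ→ℚ-homo-+ (7 ℕ.* k) 25) (cong (_+ ℕ→ℚ 25) (ℕ→ℚ-homo-* 7 k)) ⟩
    ℕ→ℚ 7 * ℕ→ℚ k + ℕ→ℚ 25           ≤⟨ ℚ.p≤q⊔p (½ * (ℕ→ℚ k * ℕ→ℚ k) + ℕ→ℚ 6 * ℕ→ℚ k + ℕ→ℚ 3) _ ⟩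
    (½ * (ℕ→ℚ k * ℕ→ℚ k) + ℕ→ℚ 6 * ℕ→ℚ k + ℕ→ℚ 3) ⊔ (ℕ→ℚ 7 * ℕ→ℚ k + ℕ→ℚ 25)     ≤⟨ max≤m ⟩
    ℕ→ℚ m                            ∎)
    where open ℚ.≤-Reasoning

  3k+5≤m : 2 ℕ.* k ℕ.+ 4 ℕ.+ suc k ℕ.≤ m
  -- The slack is `(7k + 25) - (3k + 5) = 4k + 20`.
  3k+5≤m = ℕ.≤-trans (ℕ.m≤m+n _ (4 ℕ.* k ℕ.+ 20)) (ℕ.≤-trans (ℕ.≤-reflexive (identity k)) 7k+25≤m)
    where
    identity : ∀ k → 2 ℕ.* k ℕ.+ 4 ℕ.+ suc k ℕ.+ (4 ℕ.* k ℕ.+ 20) ≡ 7 ℕ.* k ℕ.+ 25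
    identity = solve-∀

  2k+4≤D : 2 ℕ.* k ℕ.+ 4 ℕ.≤ D
  2k+4≤D = ℕ.m+n≤o⇒m≤o∸n (2 ℕ.* k ℕ.+ 4) 3k+5≤m

  k<m : suc k ℕ.≤ m
  k<m = ℕ.m+n≤o⇒n≤o (2 ℕ.* k ℕ.+ 4) 3k+5≤m

  m∸k≡1+D : m ∸ k ≡ suc D
  -- Here `m ∸ k` is read as `suc m ∸ suc k`, and `k < m` keeps the subtraction exact.
  m∸k≡1+D = ℕ.+-∸-assoc 1 k<m

  size≡ : size ≡ D ℕ.+ k ℕ.+ 1
  size≡ = trans size≡m (trans (sym (ℕ.m∸n+n≡m k<m)) (trans (ℕ.+-suc D k) (ℕ.+-comm 1 (D ℕ.+ k))))

  D+2≤q : ℕ→ℝ (D ℕ.+ 2) ≤ℝ q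
  -- The left-hand real is a constant sequence. Unfolding `_≤ℝ_` leaves only its rational value to
  -- transport, without any Cauchy proof.
  D+2≤q = subst (λ r → ∀ ε → 0ℚ < ε → ∃[ N ] (∀ i → N ℕ.≤ i → r < seq q i + ε)) m-k+1≡ m-k+1≤q
    where
    open ≡-Reasoning
    m-k+1≡ : (ℕ→ℚ m - ℕ→ℚ k) + 1ℚ ≡ ℕ→ℚ (D ℕ.+ 2)
    m-k+1≡ = begin
      (ℕ→ℚ m - ℕ→ℚ k) + 1ℚ    ≡⟨ cong (_+ 1ℚ) (ℕ→ℚ-homo-∸ (ℕ.<⇒≤ k<m)) ⟨
      ℕ→ℚ (m ∸ k) + 1ℚ        ≡⟨ ℕ→ℚ-homo-+ (m ∸ k) 1 ⟨
      ℕ→ℚ (m ∸ k ℕ.+ 1)       ≡⟨ cong (λ t → ℕ→ℚ (t ℕ.+ 1)) m∸k≡1+D ⟩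
      ℕ→ℚ (suc D ℕ.+ 1)       ≡⟨ cong ℕ→ℚ (ℕ.+-suc D 1) ⟨
      ℕ→ℚ (D ℕ.+ 2)           ∎

  module _ (low : ¬ (∃[ u ] (m ∸ k ℕ.≤ degree u))) where
    degree≤D : ∀ u → degree u ℕ.≤ D
    degree≤D u = ℕ.s≤s⁻¹ (subst (degree u ℕ.<_) m∸k≡1+D (ℕ.≰⇒> (λ m-k≤d → low (u , m-k≤d))))

    weight≤D+2 : ∀ u → weight G u ℕ.≤ D ℕ.+ 2
    weight≤D+2 u = ℕ.⊔-lub (ℕ.≤-trans (s≤s z≤n) (ℕ.m≤n+m 2 D)) (ℕ.≤-trans (degree≤D u) (ℕ.m≤m+n D 2))

    -- Qualified on purpose: an opened copy is a different name, and comparing the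
    -- two would unfold the Cauchy moduli of all entries.
    ¬eigenvalue : ¬ IsEigenvalue (Graph.signlessLaplacian G) q
    ¬eigenvalue = not-eigenvalue (Graph.signlessLaplacian G) degree (adj G) (seq-signlessLaplacian G)
      (weight G) (λ u → ℕ.m≤m⊔n 1 (degree u)) weight≤D+2
      (weight-gap G degree≤D size≡ 2k+4≤D) q D+2≤q

  conclude : Dec (∃[ u ] (m ∸ k ℕ.≤ degree u)) → G ContainsSubgraph (K₁, (m ∸ k))
  conclude (yes (u , m-k≤d)) = degree⇒star G u m-k≤d
  conclude (no low)          = contradiction eigenvalue (¬eigenvalue low)
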